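{- Let $s_1,s_2$ be positive integers and, for integers $N\ge 0$, let $$f_{s_1,s_2}(N)=\binom{s_2}{N}\sum_i\binom{s_1}{i}\binom{s_1}{N-i}\binom{N}{i}.$$ Then there is an integer $g(s_1,s_2)$ such that $f_{s_1,s_2}(N)$ is an increasing function of $N$ for $N\le g(s_1,s_2)$ and a decreasing function of $N$ for $N\ge g(s_1,s_2)$. Moreover, $$g(s_1,s_2)=\Bigl\lfloor 2s_1+s_2+\tfrac32-\sqrt{4s_1^2+4s_1+(s_2+\tfrac12)^2}\Bigr\rfloor+\delta$$ with $\delta=0$ or $\delta=1$.
   Context: Binomial coefficients $\binom{n}{k}$ are $0$ when $k<0$ or $k>n$. $\lfloor\cdot\rfloor$ denotes the integer part. If $f_{s_1,s_2}$ attains equal maximal values at two consecutive integers $N$ and $N+1$, either of them is accepted as a value of $g(s_1,s_2)$. -}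

module Defs where

open import Data.Nat using (ℕ; zero; suc; _+_; _*_; _∸_)
open import Data.Nat.Combinatorics using (_C_)
open import Data.List using (map; upTo)
open import Data.Nat.ListAction using (sum)
open import Data.Integer as ℤ using (ℤ; +_)
open import Data.Product using (_×_)
open import Data.Sum using (_⊎_)

-- f_{s1,s2}(N) = C(s2,N) * Σ_{i=0}^{N} C(s1,i) C(s1,N-i) C(N,i)
-- (terms with i > N vanish since C(N,i) = 0, and i ≤ N means N ∸ i = N - i)
f : ℕ → ℕ → ℕ → ℕ
f s₁ s₂ N = (s₂ C N) * sum (map (λ i → (s₁ C i) * (s₁ C (N ∸ i)) * (N C i)) (upTo (suc N)))

-- m = ⌊ X ⌋ where X = 2s1 + s2 + 3/2 - sqrt(D), D = 4s1² + 4s1 + (s2 + 1/2)².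
-- With A = 2s1 + s2 + 3/2 - m, i.e. 2A = 4s1 + 2s2 + 3 - 2m, and 4D = 16s1² + 16s1 + (2s2+1)²:
--   m ≤ X      ⇔  sqrt D ≤ A        ⇔  0 ≤ 2A  ∧  4D ≤ (2A)²
--   X < m + 1  ⇔  A - 1 < sqrt D    ⇔  2A - 2 < 0  ∨  (2A - 2)² < 4D
twoA : ℕ → ℕ → ℤ → ℤ
twoA s₁ s₂ m = + (4 * s₁ + 2 * s₂ + 3) ℤ.- (+ 2) ℤ.* m

fourD : ℕ → ℕ → ℤ
fourD s₁ s₂ = + (16 * s₁ * s₁ + 16 * s₁ + (2 * s₂ + 1) * (2 * s₂ + 1))

IsFloorG : ℕ → ℕ → ℤ → Set
IsFloorG s₁ s₂ m =
  (+ 0 ℤ.≤ twoA s₁ s₂ m × fourD s₁ s₂ ℤ.≤ twoA s₁ s₂ m ℤ.* twoA s₁ s₂ m)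
  × (twoA s₁ s₂ m ℤ.- + 2 ℤ.< + 0
     ⊎ (twoA s₁ s₂ m ℤ.- + 2) ℤ.* (twoA s₁ s₂ m ℤ.- + 2) ℤ.< fourD s₁ s₂)

{-# OPTIONS --safe #-}
-- Write M = 2 s₁.  Up to N!, the sum A(N) in f is the coefficient of x^N in the square
-- of a Laguerre-type polynomial, so it satisfies a three-term recurrence.  Put
--   slack(N) = 2 (M - N) A(N) - (N+1) A(N+1).
-- The recurrence says (N+1) slack(N) + N slack(N-1) = (M-N) A(N); with z = M - N it yields
--   N² (N+1) slack(N) = (N² + z) (N-1) slack(N-2) + (z+1) ((2N-1) z - N²) A(N-1).
-- The last term is ≥ 0 exactly when 3N < 2M.  Hence slack ≥ 0 follows by forward
-- induction from slack(0), slack(1) as long as 3N < 2M, and by backward induction from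
-- slack(M) = slack(M-1) = 0 otherwise.  The signs of slack(N) and slack(N+1) bound
-- A(N+1)/A(N) from above and from below, sharply enough to give f(N) ≤ f(N+1) when N+1
-- is at most X = 2s₁ + s₂ + 3/2 - √D, and f(N+1) ≤ f(N) when N > X.  Only the
-- comparison at N = ⌊X⌋ stays open; it decides δ.
module Submission where

open import Defs
open import Data.Nat as ℕ using (ℕ; zero; suc; _∸_; _≤_; _<_; _≤?_; z≤n; s≤s; s≤s⁻¹)
open import Data.Nat.Combinatorics using (_C_; nC1≡n; k>n⇒nCk≡0; nCk+nC[k+1]≡[n+1]C[k+1])
open import Data.Nat.ListAction using (sum)
open import Data.Nat.ListAction.Properties using (sum-++)
import Data.Nat.Properties as ℕ
open import Data.Nat.Tactic.RingSolver using (solve-∀)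
open import Data.Integer as ℤ using (ℤ; 0ℤ; +≤+; +<+)
import Data.Integer.Properties as ℤ
open import Data.Integer.Tactic.RingSolver using () renaming (solve-∀ to solve-∀-ℤ)
open import Data.List using (map; upTo; applyUpTo; []; _∷_; _∷ʳ_)
open import Data.List.Properties using (map-upTo; applyUpTo-∷ʳ)
open import Data.Product using (∃-syntax; _×_; _,_)
open import Data.Sum using (_⊎_; inj₁; inj₂)
open import Function using (_∘_)
open import Relation.Binary.PropositionalEquality using (_≡_; _≗_; refl; sym; trans; cong; cong₂; subst; subst₂; module ≡-Reasoning)
open import Relation.Nullary using (¬_; yes; no; contradiction)
open import Relation.Unary using (Decidable)

-- The three-term recurrence and the sign of the slack.

module _ where
  open import Data.Integer using (+_; _+_; _*_; _-_)

  excess : (M n a₀ a₁ : ℤ) → ℤ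
  excess M n a₀ a₁ = + 2 * (M - n) * a₀ - (+ 1 + n) * a₁

  Recurrence : (M n a₀ a₁ a₂ : ℤ) → Set
  Recurrence M n a₀ a₁ a₂ =
    (+ 2 + n) * ((+ 2 + n) * a₂ + (+ 1 + n) * a₁) + + 2 * ((+ 1 + n) * ((+ 1 + n) * a₁ + n * a₀))
      ≡ M * ((+ 2 * (+ 1 + n) + + 1) * a₁ + + 2 * (+ 1 + n) * a₀)

  -- Lets the ring solver exploit a hypothesis `l ≡ r`: the solver proves the claim with the
  -- difference `r - l` added to one side, and that difference is zero.
  +-cancel-eq : ∀ {l r} i → l ≡ r → i + (r - l) ≡ i
  +-cancel-eq i l≡r = trans (cong (λ t → i + t) (ℤ.i≡j⇒i-j≡0 (sym l≡r))) (ℤ.+-identityʳ i)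

  excess-step : ∀ M n a₀ a₁ a₂ → Recurrence M n a₀ a₁ a₂ →
    (+ 2 + n) * excess M (+ 1 + n) a₁ a₂ + (+ 1 + n) * excess M n a₀ a₁ ≡ (M - (+ 1 + n)) * a₁
  excess-step M n a₀ a₁ a₂ rec = trans (identity M n a₀ a₁ a₂) (+-cancel-eq _ rec)
    where
    identity : ∀ M n a₀ a₁ a₂ →
      (+ 2 + n) * (+ 2 * (M - (+ 1 + n)) * a₁ - (+ 1 + (+ 1 + n)) * a₂)
        + (+ 1 + n) * (+ 2 * (M - n) * a₀ - (+ 1 + n) * a₁)
      ≡ (M - (+ 1 + n)) * a₁
        + (M * ((+ 2 * (+ 1 + n) + + 1) * a₁ + + 2 * (+ 1 + n) * a₀)
           - ((+ 2 + n) * ((+ 2 + n) * a₂ + (+ 1 + n) * a₁) + + 2 * ((+ 1 + n) * ((+ 1 + n) * a₁ + n * a₀))))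
    identity = solve-∀-ℤ

  -- Only `a₁` and the excess at `n` remain on the right, the form needed to eliminate `a₂` between
  -- two consecutive one-step relations.
  excess-solve : ∀ M n a₀ a₁ a₂ → Recurrence M n a₀ a₁ a₂ →
    (+ 2 + n) * (+ 2 + n) * a₂ ≡ (+ 2 * n + + 3) * (M - (+ 1 + n)) * a₁ + (+ 1 + n) * excess M n a₀ a₁
  excess-solve M n a₀ a₁ a₂ rec = sym (trans (identity M n a₀ a₁ a₂) (+-cancel-eq _ rec))
    where
    identity : ∀ M n a₀ a₁ a₂ →
      (+ 2 * n + + 3) * (M - (+ 1 + n)) * a₁ + (+ 1 + n) * (+ 2 * (M - n) * a₀ - (+ 1 + n) * a₁)
      ≡ (+ 2 + n) * (+ 2 + n) * a₂
        + (M * ((+ 2 * (+ 1 + n) + + 1) * a₁ + + 2 * (+ 1 + n) * a₀)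
           - ((+ 2 + n) * ((+ 2 + n) * a₂ + (+ 1 + n) * a₁) + + 2 * ((+ 1 + n) * ((+ 1 + n) * a₁ + n * a₀))))
    identity = solve-∀-ℤ

  -- Subtracting the one-step relations at `n` and `n + 1` removes the excess in the middle;
  -- `excess-solve` then removes the remaining `a₂`, at the cost of the factor `N * N`.
  excess-two-step : ∀ M n a₀ a₁ a₂ a₃ →
    Recurrence M n a₀ a₁ a₂ → Recurrence M (+ 1 + n) a₁ a₂ a₃ →
    let N = + 2 + n ; z = M - N in
    N * N * (+ 1 + N) * excess M N a₂ a₃
      ≡ (N * N + z) * (+ 1 + n) * excess M n a₀ a₁ + (+ 1 + z) * ((+ 2 * n + + 3) * z - N * N) * a₁
  excess-two-step M n a₀ a₁ a₂ a₃ rec rec′ = combine (excess M n a₀ a₁) (excess M (+ 1 + n) a₁ a₂)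
     (excess M (+ 2 + n) a₂ a₃) (excess-step M n a₀ a₁ a₂ rec) step′ (excess-solve M n a₀ a₁ a₂ rec)
    where
    shift : ∀ n → + 1 + (+ 1 + n) ≡ + 2 + n
    shift = solve-∀-ℤ
    shift′ : ∀ n → + 2 + (+ 1 + n) ≡ + 1 + (+ 2 + n)
    shift′ = solve-∀-ℤ
    step′ : (+ 1 + (+ 2 + n)) * excess M (+ 2 + n) a₂ a₃ + (+ 2 + n) * excess M (+ 1 + n) a₁ a₂
            ≡ (M - (+ 2 + n)) * a₂
    step′ = subst₂ (λ u v → u * excess M v a₂ a₃ + v * excess M (+ 1 + n) a₁ a₂ ≡ (M - v) * a₂)
                   (shift′ n) (shift n) (excess-step M (+ 1 + n) a₁ a₂ a₃ rec′)
    combine : ∀ x₀ x₁ x₂ → let N = + 2 + n ; z = M - N in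
      N * x₁ + (+ 1 + n) * x₀ ≡ (M - (+ 1 + n)) * a₁ →
      (+ 1 + N) * x₂ + N * x₁ ≡ z * a₂ →
      N * N * a₂ ≡ (+ 2 * n + + 3) * (M - (+ 1 + n)) * a₁ + (+ 1 + n) * x₀ →
      N * N * (+ 1 + N) * x₂ ≡ (N * N + z) * (+ 1 + n) * x₀ + (+ 1 + z) * ((+ 2 * n + + 3) * z - N * N) * a₁
    combine x₀ x₁ x₂ h₁ h₂ h₃ = begin
      N * N * (+ 1 + N) * x₂
        ≡⟨ split n x₀ x₁ x₂ ⟩
      N * N * ((+ 1 + N) * x₂ + N * x₁) - N * N * (N * x₁ + (+ 1 + n) * x₀) + N * N * ((+ 1 + n) * x₀)
        ≡⟨ cong₂ (λ u v → N * N * u - N * N * v + N * N * ((+ 1 + n) * x₀)) h₂ h₁ ⟩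
      N * N * (z * a₂) - N * N * ((M - (+ 1 + n)) * a₁) + N * N * ((+ 1 + n) * x₀)
        ≡⟨ pull M n x₀ a₁ a₂ ⟩
      z * (N * N * a₂) - N * N * ((M - (+ 1 + n)) * a₁) + N * N * ((+ 1 + n) * x₀)
        ≡⟨ cong (λ u → z * u - N * N * ((M - (+ 1 + n)) * a₁) + N * N * ((+ 1 + n) * x₀)) h₃ ⟩
      z * ((+ 2 * n + + 3) * (M - (+ 1 + n)) * a₁ + (+ 1 + n) * x₀)
        - N * N * ((M - (+ 1 + n)) * a₁) + N * N * ((+ 1 + n) * x₀)
        ≡⟨ collect M n x₀ a₁ ⟩
      (N * N + z) * (+ 1 + n) * x₀ + (+ 1 + z) * ((+ 2 * n + + 3) * z - N * N) * a₁ ∎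
      where
      open ≡-Reasoning
      N = + 2 + n
      z = M - N
      split : ∀ n x₀ x₁ x₂ → let N = + 2 + n in
        N * N * (+ 1 + N) * x₂
        ≡ N * N * ((+ 1 + N) * x₂ + N * x₁) - N * N * (N * x₁ + (+ 1 + n) * x₀) + N * N * ((+ 1 + n) * x₀)
      split = solve-∀-ℤ
      pull : ∀ M n x₀ a₁ a₂ → let N = + 2 + n ; z = M - N in
        N * N * (z * a₂) - N * N * ((M - (+ 1 + n)) * a₁) + N * N * ((+ 1 + n) * x₀)
        ≡ z * (N * N * a₂) - N * N * ((M - (+ 1 + n)) * a₁) + N * N * ((+ 1 + n) * x₀)
      pull = solve-∀-ℤ
      collect : ∀ M n x₀ a₁ → let N = + 2 + n ; z = M - N in
        z * ((+ 2 * n + + 3) * (M - (+ 1 + n)) * a₁ + (+ 1 + n) * x₀)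
          - N * N * ((M - (+ 1 + n)) * a₁) + N * N * ((+ 1 + n) * x₀)
        ≡ (N * N + z) * (+ 1 + n) * x₀ + (+ 1 + z) * ((+ 2 * n + + 3) * z - N * N) * a₁
      collect = solve-∀-ℤ

  *-≥0 : ∀ {i j} → 0ℤ ℤ.≤ i → 0ℤ ℤ.≤ j → 0ℤ ℤ.≤ i * j
  *-≥0 {+ m} {+ n} _ _ = subst (0ℤ ℤ.≤_) (ℤ.pos-* m n) (+≤+ z≤n)

  *-cancel-≥0 : ∀ k {i} → .{{ℤ.Positive k}} → 0ℤ ℤ.≤ k * i → 0ℤ ℤ.≤ i
  *-cancel-≥0 k {i} h = ℤ.*-cancelˡ-≤-pos 0ℤ i k (subst (ℤ._≤ k * i) (sym (ℤ.*-zeroʳ k)) h)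

  -- The facts about `A s`, with `M = 2 * s`, from which the slack is bounded: `initial` and the
  -- recurrence determine the slack at 0 and 1, `2≤M` makes the latter nonnegative, `terminal`
  -- starts the backward induction.
  record RecurrentSequence (M : ℕ) (a : ℕ → ℕ) : Set where
    field
      recurrence : ∀ n → Recurrence (+ M) (+ n) (+ a n) (+ a (suc n)) (+ a (suc (suc n)))
      initial    : a 1 ≡ M ℕ.* a 0
      terminal   : a (suc M) ≡ 0
      2≤M        : 2 ≤ M

  module _ {M : ℕ} {a : ℕ → ℕ} (R : RecurrentSequence M a) where
    open RecurrentSequence R

    slack : ℕ → ℤ
    slack n = excess (+ M) (+ n) (+ a n) (+ a (suc n))

    private
      twoStep : ∀ n → let N = + 2 + + n ; z = + M - N in
        N * N * (+ 1 + N) * slack (suc (suc n))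
          ≡ (N * N + z) * (+ 1 + + n) * slack n + (+ 1 + z) * ((+ 2 * + n + + 3) * z - N * N) * + a (suc n)
      twoStep n = excess-two-step (+ M) (+ n) (+ a n) (+ a (suc n)) (+ a (suc (suc n))) (+ a (suc (suc (suc n))))
                    (recurrence n) (recurrence (suc n))

    slack-zero : slack 0 ≡ + M * + a 0
    slack-zero = begin
      + 2 * (+ M - + 0) * + a 0 - (+ 1 + + 0) * + a 1
        ≡⟨ cong (λ t → + 2 * (+ M - + 0) * + a 0 - (+ 1 + + 0) * t) (trans (cong +_ initial) (ℤ.pos-* M (a 0))) ⟩
      + 2 * (+ M - + 0) * + a 0 - (+ 1 + + 0) * (+ M * + a 0)
        ≡⟨ simplify (+ M) (+ a 0) ⟩
      + M * + a 0 ∎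
      where
      open ≡-Reasoning
      simplify : ∀ m b → + 2 * (m - + 0) * b - (+ 1 + + 0) * (m * b) ≡ m * b
      simplify = solve-∀-ℤ

    slack-one : + 2 * slack 1 ≡ + M * (+ M - + 2) * + a 0
    slack-one = begin
      + 2 * slack 1                                      ≡⟨ isolate (slack 1) (slack 0) ⟩
      ((+ 2 + + 0) * slack 1 + (+ 1 + + 0) * slack 0) - slack 0
        ≡⟨ cong₂ _-_ (excess-step (+ M) (+ 0) (+ a 0) (+ a 1) (+ a 2) (recurrence 0)) slack-zero ⟩
      (+ M - (+ 1 + + 0)) * + a 1 - + M * + a 0
        ≡⟨ cong (λ t → (+ M - (+ 1 + + 0)) * t - + M * + a 0) (trans (cong +_ initial) (ℤ.pos-* M (a 0))) ⟩
      (+ M - (+ 1 + + 0)) * (+ M * + a 0) - + M * + a 0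
        ≡⟨ simplify (+ M) (+ a 0) ⟩
      + M * (+ M - + 2) * + a 0 ∎
      where
      open ≡-Reasoning
      isolate : ∀ u v → + 2 * u ≡ ((+ 2 + + 0) * u + (+ 1 + + 0) * v) - v
      isolate = solve-∀-ℤ
      simplify : ∀ m b → (m - (+ 1 + + 0)) * (m * b) - m * b ≡ m * (m - + 2) * b
      simplify = solve-∀-ℤ

    private
      -≥0 : ∀ {m n} → m ≤ n → 0ℤ ℤ.≤ + n - + m
      -≥0 m≤n = ℤ.i≤j⇒0≤j-i (+≤+ m≤n)

      3n≤3N : ∀ n → let N = 2 ℕ.+ n in n ℕ.+ n ℕ.+ n ≤ N ℕ.+ N ℕ.+ N
      3n≤3N n = ℕ.+-mono-≤ (ℕ.+-mono-≤ (ℕ.m≤n+m n 2) (ℕ.m≤n+m n 2)) (ℕ.m≤n+m n 2)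

    slack≥0-low : ∀ n → n ℕ.+ n ℕ.+ n < M ℕ.+ M → 0ℤ ℤ.≤ slack n
    slack≥0-low zero          _ = subst (0ℤ ℤ.≤_) (sym slack-zero) (*-≥0 {+ M} {+ a 0} (+≤+ z≤n) (+≤+ z≤n))
    slack≥0-low (suc zero)    _ = *-cancel-≥0 (+ 2)
      (subst (0ℤ ℤ.≤_) (sym slack-one) (*-≥0 {j = + a 0} (*-≥0 {+ M} (+≤+ z≤n) (-≥0 2≤M)) (+≤+ z≤n)))
    slack≥0-low (suc (suc n)) 3N<2M = *-cancel-≥0 (N * N * (+ 1 + N))
      (subst (0ℤ ℤ.≤_) (sym (twoStep n))
        (ℤ.+-mono-≤ (*-≥0 (*-≥0 (ℤ.+-mono-≤ {0ℤ} {N * N} (+≤+ z≤n) z≥0) (+≤+ z≤n)) (slack≥0-low n 3n<2M))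
                    (*-≥0 (*-≥0 (ℤ.+-mono-≤ (+≤+ {n = 1} z≤n) z≥0) gap≥0) (+≤+ z≤n))))
      where
      N = + 2 + + n
      z = + M - N
      -- The hypothesis as a nonnegative integer: `2z` and `2gap` write twice `z` and twice the
      -- sign-deciding factor as a nonnegative multiple of `k` plus a positive remainder.
      k = (+ M + + M) - (+ 1 + (N + N + N))
      k≥0 : 0ℤ ℤ.≤ k
      k≥0 = -≥0 3N<2M
      3n<2M : n ℕ.+ n ℕ.+ n < M ℕ.+ M
      3n<2M = ℕ.≤-trans (s≤s (3n≤3N n)) 3N<2M
      2z : ∀ m n → (+ 1 + (+ 2 + n)) + ((m + m) - (+ 1 + ((+ 2 + n) + (+ 2 + n) + (+ 2 + n)))) ≡ + 2 * (m - (+ 2 + n))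
      2z = solve-∀-ℤ
      z≥0 : 0ℤ ℤ.≤ z
      z≥0 = *-cancel-≥0 (+ 2) (subst (0ℤ ℤ.≤_) (2z (+ M) (+ n)) (ℤ.+-mono-≤ (+≤+ {n = suc (suc (suc n))} z≤n) k≥0))
      2gap : ∀ m n → let N = + 2 + n ; z = m - N in
        (+ 2 * n + + 3) * ((m + m) - (+ 1 + (N + N + N))) + (+ 1 + n) ≡ + 2 * ((+ 2 * n + + 3) * z - N * N)
      2gap = solve-∀-ℤ
      gap≥0 : 0ℤ ℤ.≤ (+ 2 * + n + + 3) * z - N * N
      gap≥0 = *-cancel-≥0 (+ 2) (subst (0ℤ ℤ.≤_) (2gap (+ M) (+ n))
        (ℤ.+-mono-≤ (*-≥0 (ℤ.+-mono-≤ (*-≥0 {+ 2} {+ n} (+≤+ z≤n) (+≤+ z≤n)) (+≤+ {n = 3} z≤n)) k≥0) (+≤+ {n = suc n} z≤n)))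

    slack-end : ∀ n → n ≡ M → slack n ≡ 0ℤ
    slack-end n refl = begin
      + 2 * (+ n - + n) * + a n - (+ 1 + + n) * + a (suc n)
        ≡⟨ cong (λ t → + 2 * (+ n - + n) * + a n - (+ 1 + + n) * + t) terminal ⟩
      + 2 * (+ n - + n) * + a n - (+ 1 + + n) * + 0
        ≡⟨ simplify (+ n) (+ a n) ⟩
      0ℤ ∎
      where
      open ≡-Reasoning
      simplify : ∀ n b → + 2 * (n - n) * b - (+ 1 + n) * + 0 ≡ + 0
      simplify = solve-∀-ℤ

    slack-beforeEnd : ∀ n → suc n ≡ M → (+ 1 + + n) * slack n ≡ 0ℤ
    slack-beforeEnd n e = begin
      (+ 1 + + n) * slack n
        ≡⟨ isolate (+ n) (slack n) ⟩
      (+ 2 + + n) * 0ℤ + (+ 1 + + n) * slack n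
        ≡⟨ cong (λ t → (+ 2 + + n) * t + (+ 1 + + n) * slack n) (slack-end (suc n) e) ⟨
      (+ 2 + + n) * slack (suc n) + (+ 1 + + n) * slack n
        ≡⟨ excess-step (+ M) (+ n) (+ a n) (+ a (suc n)) (+ a (suc (suc n))) (recurrence n) ⟩
      (+ M - + suc n) * + a (suc n)
        ≡⟨ cong (λ t → t * + a (suc n)) (ℤ.i≡j⇒i-j≡0 (cong +_ (sym e))) ⟩
      0ℤ * + a (suc n) ≡⟨ ℤ.*-zeroˡ (+ a (suc n)) ⟩
      0ℤ ∎
      where
      open ≡-Reasoning
      isolate : ∀ n u → (+ 1 + n) * u ≡ (+ 2 + n) * + 0 + (+ 1 + n) * u
      isolate = solve-∀-ℤ

    -- The bound concerns `n + 2` because the identity linking the slack at `n` and at `N = n + 2`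
    -- takes its sign from `N`. Steps of two require both base cases `n = M` and `n = M - 1`.
    slack≥0-high : ∀ d n → n ℕ.+ d ≡ M → M ℕ.+ M ≤ (2 ℕ.+ n) ℕ.+ (2 ℕ.+ n) ℕ.+ (2 ℕ.+ n) → 0ℤ ℤ.≤ slack n
    slack≥0-high zero          n e _ = ℤ.≤-reflexive (sym (slack-end n (trans (sym (ℕ.+-identityʳ n)) e)))
    slack≥0-high (suc zero)    n e _ = *-cancel-≥0 (+ 1 + + n)
      (ℤ.≤-reflexive (sym (slack-beforeEnd n (trans (ℕ.+-comm 1 n) e))))
    -- The factor to be cancelled is stated with `+ d` in place of `z`, which makes it positive by
    -- computation.
    slack≥0-high (suc (suc d)) n e 2M≤3N = *-cancel-≥0 ((N * N + + d) * (+ 1 + + n))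
      (subst (λ t → 0ℤ ℤ.≤ (N * N + t) * (+ 1 + + n) * slack n) z≡d
        (subst (0ℤ ℤ.≤_) (sym flip)
          (ℤ.+-mono-≤ (*-≥0 {N * N * (+ 1 + N)} (+≤+ z≤n) xN≥0)
                      (*-≥0 (*-≥0 (ℤ.+-mono-≤ (+≤+ {n = 1} z≤n) z≥0) gap≥0) (+≤+ z≤n)))))
      where
      N = + 2 + + n
      z = + M - N
      2+n+d≡M : suc (suc n) ℕ.+ d ≡ M
      2+n+d≡M = trans (sym (trans (ℕ.+-suc n (suc d)) (cong suc (ℕ.+-suc n d)))) e
      z≡d : z ≡ + d
      z≡d = trans (cong (λ t → + t - N) (sym 2+n+d≡M)) (simplify (+ n) (+ d))
        where
        simplify : ∀ n d → + 2 + n + d - (+ 2 + n) ≡ d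
        simplify = solve-∀-ℤ
      z≥0 : 0ℤ ℤ.≤ z
      z≥0 = subst (0ℤ ℤ.≤_) (sym z≡d) (+≤+ z≤n)
      xN≥0 : 0ℤ ℤ.≤ slack (suc (suc n))
      xN≥0 = slack≥0-high d (suc (suc n)) 2+n+d≡M
               (ℕ.≤-trans 2M≤3N (3n≤3N (suc (suc n))))
      2gap : ∀ m n → let N = + 2 + n ; z = m - N in
        (+ 2 * n + + 3) * ((N + N + N) - (m + m)) + N ≡ + 2 * (N * N - (+ 2 * n + + 3) * z)
      2gap = solve-∀-ℤ
      gap≥0 : 0ℤ ℤ.≤ N * N - (+ 2 * + n + + 3) * z
      gap≥0 = *-cancel-≥0 (+ 2) (subst (0ℤ ℤ.≤_) (2gap (+ M) (+ n))
        (ℤ.+-mono-≤ (*-≥0 (ℤ.+-mono-≤ (*-≥0 {+ 2} {+ n} (+≤+ z≤n) (+≤+ z≤n)) (+≤+ {n = 3} z≤n)) (-≥0 2M≤3N))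
                    (+≤+ {n = 2 ℕ.+ n} z≤n)))
      flip : (N * N + z) * (+ 1 + + n) * slack n
             ≡ N * N * (+ 1 + N) * slack (suc (suc n)) + (+ 1 + z) * (N * N - (+ 2 * + n + + 3) * z) * + a (suc n)
      flip = trans (move ((N * N + z) * (+ 1 + + n) * slack n) (+ 1 + z) (N * N) ((+ 2 * + n + + 3) * z) (+ a (suc n)))
                   (cong (λ t → t + (+ 1 + z) * (N * N - (+ 2 * + n + + 3) * z) * + a (suc n)) (sym (twoStep n)))
        where
        move : ∀ p c g h b → p ≡ (p + c * (h - g) * b) + c * (g - h) * b
        move = solve-∀-ℤ

    slack≥0 : ∀ n → n ≤ M → 0ℤ ℤ.≤ slack n
    slack≥0 n n≤M with n ℕ.+ n ℕ.+ n ℕ.<? M ℕ.+ M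
    ... | yes 3n<2M = slack≥0-low n 3n<2M
    ... | no  3n≮2M = slack≥0-high (M ∸ n) n (ℕ.m+[n∸m]≡n n≤M)
            (ℕ.≤-trans (ℕ.≮⇒≥ 3n≮2M) (3n≤3N n))

    ratio-upper : ∀ n z → n ℕ.+ z ≡ M → suc n ℕ.* a (suc n) ≤ 2 ℕ.* z ℕ.* a n
    ratio-upper n z e = ℤ.drop‿+≤+ (subst₂ ℤ._≤_ (sym (ℤ.pos-* (suc n) (a (suc n)))) upper
      (ℤ.0≤i-j⇒j≤i (slack≥0 n (subst (n ≤_) e (ℕ.m≤m+n n z)))))
      where
      simplify : ∀ n z → n + z - n ≡ z
      simplify = solve-∀-ℤ
      upper : + 2 * (+ M - + n) * + a n ≡ + (2 ℕ.* z ℕ.* a n)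
      upper = begin
        + 2 * (+ M - + n) * + a n
          ≡⟨ cong (λ t → + 2 * t * + a n) (trans (cong (λ t → + t - + n) (sym e)) (simplify (+ n) (+ z))) ⟩
        + 2 * + z * + a n          ≡⟨ cong (λ t → t * + a n) (ℤ.pos-* 2 z) ⟨
        + (2 ℕ.* z) * + a n        ≡⟨ ℤ.pos-* (2 ℕ.* z) (a n) ⟨
        + (2 ℕ.* z ℕ.* a n)        ∎
        where open ≡-Reasoning

    -- Nonnegativity of the slack at `suc n` involves `a (suc (suc n))`; the one-step relation
    -- trades that term for `a n`.
    ratio-lower : ∀ n z → n ℕ.+ suc z ≡ M →
      2 ℕ.* suc z ℕ.* (suc n ℕ.* a n) ≤ (n ℕ.* n ℕ.+ 2 ℕ.* n ℕ.+ suc z) ℕ.* a (suc n)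
    ratio-lower n z e = ℤ.drop‿+≤+ (subst₂ ℤ._≤_ (sym left) (sym right)
      (ℤ.0≤i-j⇒j≤i (subst (0ℤ ℤ.≤_) difference
        (*-≥0 {+ 2 + + n} (+≤+ z≤n) (slack≥0 (suc n) (subst (suc n ≤_) e n<n+1+z))))))
      where
      open ≡-Reasoning
      n<n+1+z : suc n ≤ n ℕ.+ suc z
      n<n+1+z = subst (suc n ≤_) (sym (ℕ.+-suc n z)) (ℕ.m≤m+n (suc n) z)
      a₀ = + a n
      a₁ = + a (suc n)
      Z = + suc z
      left : + (2 ℕ.* suc z ℕ.* (suc n ℕ.* a n)) ≡ + 2 * Z * ((+ 1 + + n) * a₀)
      left = trans (ℤ.pos-* (2 ℕ.* suc z) _) (cong₂ _*_ (ℤ.pos-* 2 (suc z)) (ℤ.pos-* (suc n) (a n)))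
      right : + ((n ℕ.* n ℕ.+ 2 ℕ.* n ℕ.+ suc z) ℕ.* a (suc n)) ≡ (+ n * + n + + 2 * + n + Z) * a₁
      right = trans (ℤ.pos-* (n ℕ.* n ℕ.+ 2 ℕ.* n ℕ.+ suc z) _)
                    (cong (λ t → (t + Z) * a₁) (cong₂ _+_ (ℤ.pos-* n n) (ℤ.pos-* 2 n)))
      isolate : ∀ m n a b t → t ≡ (t + (+ 1 + n) * (+ 2 * (m - n) * a - (+ 1 + n) * b))
                                  - (+ 1 + n) * (+ 2 * (m - n) * a - (+ 1 + n) * b)
      isolate = solve-∀-ℤ
      collect : ∀ n z a b →
        ((n + z) - (+ 1 + n)) * b - (+ 1 + n) * (+ 2 * ((n + z) - n) * a - (+ 1 + n) * b)
        ≡ (n * n + + 2 * n + z) * b - + 2 * z * ((+ 1 + n) * a)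
      collect = solve-∀-ℤ
      difference : (+ 2 + + n) * slack (suc n)
                   ≡ (+ n * + n + + 2 * + n + Z) * a₁ - + 2 * Z * ((+ 1 + + n) * a₀)
      difference = begin
        (+ 2 + + n) * slack (suc n)
          ≡⟨ isolate (+ M) (+ n) a₀ a₁ ((+ 2 + + n) * slack (suc n)) ⟩
        ((+ 2 + + n) * slack (suc n) + (+ 1 + + n) * slack n) - (+ 1 + + n) * slack n
          ≡⟨ cong (λ t → t - (+ 1 + + n) * slack n)
               (excess-step (+ M) (+ n) a₀ a₁ (+ a (suc (suc n))) (recurrence n)) ⟩
        (+ M - (+ 1 + + n)) * a₁ - (+ 1 + + n) * slack n
          ≡⟨ cong (λ t → (+ t - (+ 1 + + n)) * a₁ - (+ 1 + + n) * (+ 2 * (+ t - + n) * a₀ - (+ 1 + + n) * a₁)) (sym e) ⟩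
        ((+ n + Z) - (+ 1 + + n)) * a₁ - (+ 1 + + n) * (+ 2 * ((+ n + Z) - + n) * a₀ - (+ 1 + + n) * a₁)
          ≡⟨ collect (+ n) Z a₀ a₁ ⟩
        (+ n * + n + + 2 * + n + Z) * a₁ - + 2 * Z * ((+ 1 + + n) * a₀) ∎

-- Products of exponential generating functions.

open import Data.Nat using (_+_; _*_)
open import Data.Nat.Properties

-- Leibniz-rule form of the binomial convolution Σ C(N,i) p(i) q(N-i), i.e. the
-- product of exponential generating functions; `_∘ suc` is the derivative d/dx.
infix 8 _⊛_
_⊛_ : (ℕ → ℕ) → (ℕ → ℕ) → ℕ → ℕ
(p ⊛ q) zero    = p 0 * q 0
(p ⊛ q) (suc N) = (p ∘ suc ⊛ q) N + (p ⊛ q ∘ suc) N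

-- The Euler operator x d/dx.
θ : (ℕ → ℕ) → ℕ → ℕ
θ p i = i * p i

⊛-congˡ : ∀ {p p′} q → p ≗ p′ → p ⊛ q ≗ p′ ⊛ q
⊛-congˡ q h zero    = cong (_* q 0) (h 0)
⊛-congˡ q h (suc N) = cong₂ _+_ (⊛-congˡ q (h ∘ suc) N) (⊛-congˡ (q ∘ suc) h N)

⊛-comm : ∀ p q → p ⊛ q ≗ q ⊛ p
⊛-comm p q zero    = *-comm (p 0) (q 0)
⊛-comm p q (suc N) = trans (cong₂ _+_ (⊛-comm (p ∘ suc) q N) (⊛-comm p (q ∘ suc) N))
                           (+-comm ((q ⊛ p ∘ suc) N) ((q ∘ suc ⊛ p) N))

+-medial : ∀ a b c d → (a + b) + (c + d) ≡ (a + c) + (b + d)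
+-medial = solve-∀

⊛-distribʳ-+ : ∀ p p′ q N → ((λ i → p i + p′ i) ⊛ q) N ≡ (p ⊛ q) N + (p′ ⊛ q) N
⊛-distribʳ-+ p p′ q zero    = *-distribʳ-+ (q 0) (p 0) (p′ 0)
⊛-distribʳ-+ p p′ q (suc N) =
  trans (cong₂ _+_ (⊛-distribʳ-+ (p ∘ suc) (p′ ∘ suc) q N) (⊛-distribʳ-+ p p′ (q ∘ suc) N))
        (+-medial ((p ∘ suc ⊛ q) N) _ _ _)

⊛-distribˡ-+ : ∀ p q q′ N → (p ⊛ (λ i → q i + q′ i)) N ≡ (p ⊛ q) N + (p ⊛ q′) N
⊛-distribˡ-+ p q q′ N =
  trans (⊛-comm p _ N)
 (trans (⊛-distribʳ-+ q q′ p N) (cong₂ _+_ (⊛-comm q p N) (⊛-comm q′ p N)))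

⊛-*ˡ : ∀ c p q N → ((λ i → c * p i) ⊛ q) N ≡ c * (p ⊛ q) N
⊛-*ˡ c p q zero    = *-assoc c (p 0) (q 0)
⊛-*ˡ c p q (suc N) =
  trans (cong₂ _+_ (⊛-*ˡ c (p ∘ suc) q N) (⊛-*ˡ c p (q ∘ suc) N))
        (sym (*-distribˡ-+ c ((p ∘ suc ⊛ q) N) _))

-- Leibniz rule for x d/dx. The induction rests on (θp)′ = p′ + θ(p′), which holds by unfolding
-- `θ p (suc i)`.
⊛-θ : ∀ p q N → N * (p ⊛ q) N ≡ (θ p ⊛ q) N + (p ⊛ θ q) N
⊛-θ p q zero    = sym (*-zeroʳ (p 0))
⊛-θ p q (suc N) = begin
  suc N * (a + b)                                ≡⟨ expand N a b ⟩
  a + b + (N * a + N * b)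
    ≡⟨ cong₂ (λ x y → a + b + (x + y)) (⊛-θ p↑ q N) (⊛-θ p q↑ N) ⟩
  a + b + ((c + d) + (e + g))                     ≡⟨ regroup a b c d e g ⟩
  ((a + c) + e) + (d + (b + g))
    ≡⟨ cong₂ (λ x y → (x + e) + (d + y))
             (sym (⊛-distribʳ-+ p↑ (θ p↑) q N)) (sym (⊛-distribˡ-+ p q↑ (θ q↑) N)) ⟩
  (θ p ⊛ q) (suc N) + (p ⊛ θ q) (suc N)           ∎
  where
  open ≡-Reasoning
  p↑ = p ∘ suc
  q↑ = q ∘ suc
  a = (p↑ ⊛ q) N
  b = (p ⊛ q↑) N
  c = (θ p↑ ⊛ q) N
  d = (p↑ ⊛ θ q) N
  e = (θ p ⊛ q↑) N
  g = (p ⊛ θ q↑) N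
  expand : ∀ n x y → suc n * (x + y) ≡ x + y + (n * x + n * y)
  expand = solve-∀
  regroup : ∀ a b c d e g → a + b + ((c + d) + (e + g)) ≡ ((a + c) + e) + (d + (b + g))
  regroup = solve-∀

-- `θ p` has generating function x p′; under the normalisation by N!, multiplication by x shifts the
-- index and brings in the factor `suc N`.
⊛-θˡ-suc : ∀ p q N → (θ p ⊛ q) (suc N) ≡ suc N * (p ∘ suc ⊛ q) N
⊛-θˡ-suc p q zero    = simplify (p 1) (q 0)
  where
  simplify : ∀ x y → (x + 0) * y + 0 ≡ x * y + 0
  simplify = solve-∀
⊛-θˡ-suc p q (suc N) = begin
  (θ p ∘ suc ⊛ q) (suc N) + (θ p ⊛ q ∘ suc) (suc N)
    ≡⟨ cong₂ _+_ (⊛-distribʳ-+ p↑ (θ p↑) q (suc N)) (⊛-θˡ-suc p (q ∘ suc) N) ⟩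
  (p↑ ⊛ q) (suc N) + (θ p↑ ⊛ q) (suc N) + suc N * b
    ≡⟨ cong (λ x → (p↑ ⊛ q) (suc N) + x + suc N * b) (⊛-θˡ-suc p↑ q N) ⟩
  (a + b) + suc N * a + suc N * b
    ≡⟨ collect N a b ⟩
  suc (suc N) * (p↑ ⊛ q) (suc N) ∎
  where
  open ≡-Reasoning
  p↑ = p ∘ suc
  a = (p↑ ∘ suc ⊛ q) N
  b = (p↑ ⊛ q ∘ suc) N
  collect : ∀ n x y → (x + y) + suc n * x + suc n * y ≡ suc (suc n) * (x + y)
  collect = solve-∀

⊛-zero : ∀ p q N → (∀ i j → i + j ≡ N → p i * q j ≡ 0) → (p ⊛ q) N ≡ 0
⊛-zero p q zero    h = h 0 0 refl
⊛-zero p q (suc N) h =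
  cong₂ _+_ (⊛-zero (p ∘ suc) q N λ i j e → h (suc i) j (cong suc e))
            (⊛-zero p (q ∘ suc) N λ i j e → h i (suc j) (trans (+-suc i j) (cong suc e)))

-- Agreement of the product with the explicit binomial sum.

Σ< : ℕ → (ℕ → ℕ) → ℕ
Σ< n t = sum (applyUpTo t n)

-- `applyUpTo` unfolds at the front, so the first summand splits off by computation and only the
-- last one requires an argument.
Σ<-last : ∀ n t → Σ< (suc n) t ≡ Σ< n t + t n
Σ<-last n t = begin
  sum (applyUpTo t (suc n))     ≡⟨ cong sum (applyUpTo-∷ʳ t n) ⟨
  sum (applyUpTo t n ∷ʳ t n)    ≡⟨ sum-++ (applyUpTo t n) (t n ∷ []) ⟩
  Σ< n t + (t n + 0)            ≡⟨ cong (Σ< n t +_) (+-identityʳ (t n)) ⟩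
  Σ< n t + t n                  ∎
  where open ≡-Reasoning

Σ<-cong : ∀ n {t t′} → (∀ i → i < n → t i ≡ t′ i) → Σ< n t ≡ Σ< n t′
Σ<-cong zero    h = refl
Σ<-cong (suc n) h = cong₂ _+_ (h 0 (s≤s z≤n)) (Σ<-cong n λ i i<n → h (suc i) (s≤s i<n))

Σ<-+ : ∀ n t t′ → Σ< n (λ i → t i + t′ i) ≡ Σ< n t + Σ< n t′
Σ<-+ zero    t t′ = refl
Σ<-+ (suc n) t t′ = trans (cong (t 0 + t′ 0 +_) (Σ<-+ n (t ∘ suc) (t′ ∘ suc)))
                          (+-medial (t 0) (t′ 0) _ _)

convolutionTerm : (ℕ → ℕ) → (ℕ → ℕ) → ℕ → ℕ → ℕ
convolutionTerm p q N i = p i * q (N ∸ i) * (N C i)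

-- Pascal's rule recombines the two sums of the product rule, once the second is extended by a zero
-- summand and its summand at 0 is split off.
⊛-sum : ∀ p q N → (p ⊛ q) N ≡ Σ< (suc N) (convolutionTerm p q N)
⊛-sum p q zero    = simplify (p 0 * q 0)
  where
  simplify : ∀ x → x ≡ x * 1 + 0
  simplify = solve-∀
⊛-sum p q (suc N) = begin
  (p ∘ suc ⊛ q) N + (p ⊛ q ∘ suc) N
    ≡⟨ cong₂ _+_ (⊛-sum (p ∘ suc) q N) (⊛-sum p (q ∘ suc) N) ⟩
  Σ< (suc N) (convolutionTerm (p ∘ suc) q N) + Σ< (suc N) (convolutionTerm p (q ∘ suc) N)
    ≡⟨ cong (Σ< (suc N) (convolutionTerm (p ∘ suc) q N) +_) (Σ<-cong (suc N) shift) ⟩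
  Σ< (suc N) (convolutionTerm (p ∘ suc) q N) + Σ< (suc N) t
    ≡⟨ cong (Σ< (suc N) (convolutionTerm (p ∘ suc) q N) +_) extend ⟩
  Σ< (suc N) (convolutionTerm (p ∘ suc) q N) + (t 0 + Σ< (suc N) (t ∘ suc))
    ≡⟨ swap (Σ< (suc N) (convolutionTerm (p ∘ suc) q N)) (t 0) _ ⟩
  t 0 + (Σ< (suc N) (convolutionTerm (p ∘ suc) q N) + Σ< (suc N) (t ∘ suc))
    ≡⟨ cong (t 0 +_) (Σ<-+ (suc N) (convolutionTerm (p ∘ suc) q N) (t ∘ suc)) ⟨
  t 0 + Σ< (suc N) (λ i → convolutionTerm (p ∘ suc) q N i + t (suc i))
    ≡⟨ cong (t 0 +_) (Σ<-cong (suc N) λ i _ → pascal i) ⟩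
  t 0 + Σ< (suc N) (convolutionTerm p q (suc N) ∘ suc) ∎
  where
  open ≡-Reasoning
  t : ℕ → ℕ
  t i = p i * q (suc N ∸ i) * (N C i)
  shift : ∀ i → i < suc N → convolutionTerm p (q ∘ suc) N i ≡ t i
  -- `i ≤ N` is what allows `suc` to pass through the truncated subtraction.
  shift i (s≤s i≤N) = cong (λ k → p i * q k * (N C i)) (sym (+-∸-assoc 1 i≤N))
  swap : ∀ x y z → x + (y + z) ≡ y + (x + z)
  swap = solve-∀
  extend : Σ< (suc N) t ≡ Σ< (suc (suc N)) t
  extend = begin
    Σ< (suc N) t                  ≡⟨ +-identityʳ _ ⟨
    Σ< (suc N) t + 0              ≡⟨ cong (Σ< (suc N) t +_) (*-zeroʳ (p (suc N) * q (N ∸ N))) ⟨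
    Σ< (suc N) t + p (suc N) * q (N ∸ N) * 0
      ≡⟨ cong (λ c → Σ< (suc N) t + p (suc N) * q (N ∸ N) * c) (k>n⇒nCk≡0 (n<1+n N)) ⟨
    Σ< (suc N) t + t (suc N)      ≡⟨ Σ<-last (suc N) t ⟨
    Σ< (suc (suc N)) t            ∎
  pascal : ∀ i → convolutionTerm (p ∘ suc) q N i + t (suc i) ≡ convolutionTerm p q (suc N) (suc i)
  pascal i = trans (sym (*-distribˡ-+ (p (suc i) * q (N ∸ i)) (N C i) (N C suc i)))
                   (cong (p (suc i) * q (N ∸ i) *_) (nCk+nC[k+1]≡[n+1]C[k+1] N i))

-- The recurrence for the coefficients of y².

C-absorption : ∀ n i → suc i * (n C suc i) + i * (n C i) ≡ n * (n C i)
C-absorption zero    zero    = refl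
C-absorption zero    (suc i) = cong₂ _+_ (*-zeroʳ (suc (suc i))) (*-zeroʳ (suc i))
C-absorption (suc n) zero    = trans (cong (λ c → 1 * c + 0) (nC1≡n (suc n))) (simplify (suc n))
  where
  simplify : ∀ m → 1 * m + 0 ≡ m * 1
  simplify = solve-∀
-- Pascal's rule reduces the claim to the sum of the induction hypotheses at `i` and `suc i`.
C-absorption (suc n) (suc i) = begin
  suc (suc i) * (suc n C suc (suc i)) + suc i * (suc n C suc i)
    ≡⟨ cong₂ (λ x y → suc (suc i) * x + suc i * y) (pascal (suc i)) (pascal i) ⟨
  suc (suc i) * (b + c) + suc i * (a + b)
    ≡⟨ regroup i a b c ⟩
  (suc (suc i) * c + suc i * b) + (suc i * b + i * a) + (a + b)
    ≡⟨ cong₂ (λ x y → x + y + (a + b)) (C-absorption n (suc i)) (C-absorption n i) ⟩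
  n * b + n * a + (a + b)
    ≡⟨ collect n a b ⟩
  suc n * (a + b)
    ≡⟨ cong (suc n *_) (pascal i) ⟩
  suc n * (suc n C suc i) ∎
  where
  open ≡-Reasoning
  a = n C i
  b = n C suc i
  c = n C suc (suc i)
  pascal = nCk+nC[k+1]≡[n+1]C[k+1] n
  regroup : ∀ i a b c → suc (suc i) * (b + c) + suc i * (a + b)
                      ≡ (suc (suc i) * c + suc i * b) + (suc i * b + i * a) + (a + b)
  regroup = solve-∀
  collect : ∀ n a b → n * b + n * a + (a + b) ≡ suc n * (a + b)
  collect = solve-∀

-- A s N / N! is the coefficient of x^N in the square of y = Σ C(s,i) x^i / i!.
A : ℕ → ℕ → ℕ
A s = (s C_) ⊛ (s C_)

f-factor : ∀ s₁ s₂ N → f s₁ s₂ N ≡ (s₂ C N) * A s₁ N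
f-factor s₁ s₂ N = cong ((s₂ C N) *_) (begin
  sum (map (convolutionTerm (s₁ C_) (s₁ C_) N) (upTo (suc N)))
    ≡⟨ cong sum (map-upTo (convolutionTerm (s₁ C_) (s₁ C_) N) (suc N)) ⟩
  Σ< (suc N) (convolutionTerm (s₁ C_) (s₁ C_) N)  ≡⟨ ⊛-sum (s₁ C_) (s₁ C_) N ⟨
  A s₁ N                                          ∎)
  where open ≡-Reasoning

-- The polynomial y has degree `s`, so its square has degree `2 * s`.
A-zero : ∀ s N → 2 * s < N → A s N ≡ 0
A-zero s N 2s<N = ⊛-zero (s C_) (s C_) N vanish
  where
  vanish : ∀ i j → i + j ≡ N → (s C i) * (s C j) ≡ 0
  vanish i j e with <-≤-connex s i | <-≤-connex s j
  ... | inj₁ s<i | _        = cong (_* (s C j)) (k>n⇒nCk≡0 s<i)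
  ... | inj₂ _   | inj₁ s<j = trans (cong ((s C i) *_) (k>n⇒nCk≡0 s<j)) (*-zeroʳ (s C i))
  ... | inj₂ i≤s | inj₂ j≤s = contradiction 2s<N (≤⇒≯ (begin
    N      ≡⟨ e ⟨
    i + j  ≤⟨ +-mono-≤ i≤s (≤-trans j≤s (≤-reflexive (sym (+-identityʳ s)))) ⟩
    2 * s  ∎))
    where
    open ≤-Reasoning

-- With y as above, x y″ + (1 + x) y′ = s y.  Together with θ(y²) = 2 y (θy) this
-- gives a closed first-order system for y², y (θy) and (θy)², from which the last
-- two are eliminated.
module _ (s : ℕ) where
  private
    y u : ℕ → ℕ
    y = s C_
    u = θ y
    B Q : ℕ → ℕ
    B = u ⊛ y
    Q = u ⊛ u

    A-B : ∀ N → N * A s N ≡ 2 * B N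
    A-B N = begin
      N * A s N                ≡⟨ ⊛-θ y y N ⟩
      B N + (y ⊛ u) N          ≡⟨ cong (B N +_) (⊛-comm y u N) ⟩
      B N + B N                ≡⟨ cong (B N +_) (+-identityʳ (B N)) ⟨
      2 * B N                  ∎
      where open ≡-Reasoning

    -- The differential equation in the form (θy)′ + θy = s y, multiplied by an arbitrary `q`;
    -- coefficientwise it is `C-absorption`.
    u-ode : ∀ q N → (u ∘ suc ⊛ q) N + (u ⊛ q) N ≡ s * (y ⊛ q) N
    u-ode q N = begin
      (u ∘ suc ⊛ q) N + (u ⊛ q) N            ≡⟨ ⊛-distribʳ-+ (u ∘ suc) u q N ⟨
      ((λ i → u (suc i) + u i) ⊛ q) N        ≡⟨ ⊛-congˡ q (C-absorption s) N ⟩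
      ((λ i → s * y i) ⊛ q) N                ≡⟨ ⊛-*ˡ s y q N ⟩
      s * (y ⊛ q) N                          ∎
      where open ≡-Reasoning

    -- Coefficients of θ(y θy) = y θ(θy) + (θy)², where θ(θy) = x (θy)′ = x (s y - θy).
    B-Q : ∀ N → suc N * B (suc N) + suc N * B N ≡ Q (suc N) + suc N * (s * A s N)
    B-Q N = begin
      suc N * B (suc N) + suc N * B N
        ≡⟨ cong (_+ suc N * B N) (⊛-θ u y (suc N)) ⟩
      (θ u ⊛ y) (suc N) + Q (suc N) + suc N * B N
        ≡⟨ cong (λ x → x + Q (suc N) + suc N * B N) (⊛-θˡ-suc u y N) ⟩
      suc N * (u ∘ suc ⊛ y) N + Q (suc N) + suc N * B N
        ≡⟨ regroup (suc N) _ (Q (suc N)) (B N) ⟩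
      Q (suc N) + suc N * ((u ∘ suc ⊛ y) N + B N)
        ≡⟨ cong (λ x → Q (suc N) + suc N * x) (u-ode y N) ⟩
      Q (suc N) + suc N * (s * A s N) ∎
      where
      open ≡-Reasoning
      regroup : ∀ n a b c → n * a + b + n * c ≡ b + n * (a + c)
      regroup = solve-∀

    -- θ((θy)²) = 2 (θy) θ(θy) carries a factor x; cancelling `suc N` divides it out.
    Q-B : ∀ N → Q (suc N) + 2 * Q N ≡ 2 * (s * B N)
    Q-B N = *-cancelˡ-≡ _ _ (suc N) (begin
      suc N * (Q (suc N) + 2 * Q N)
        ≡⟨ *-distribˡ-+ (suc N) (Q (suc N)) _ ⟩
      suc N * Q (suc N) + suc N * (2 * Q N)
        ≡⟨ cong (_+ suc N * (2 * Q N)) (⊛-θ u u (suc N)) ⟩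
      (θ u ⊛ u) (suc N) + (u ⊛ θ u) (suc N) + suc N * (2 * Q N)
        ≡⟨ cong (λ x → (θ u ⊛ u) (suc N) + x + suc N * (2 * Q N)) (⊛-comm u (θ u) (suc N)) ⟩
      (θ u ⊛ u) (suc N) + (θ u ⊛ u) (suc N) + suc N * (2 * Q N)
        ≡⟨ cong (λ x → x + x + suc N * (2 * Q N)) (⊛-θˡ-suc u u N) ⟩
      suc N * a + suc N * a + suc N * (2 * Q N)
        ≡⟨ regroup (suc N) a (Q N) ⟩
      suc N * (2 * (a + Q N))
        ≡⟨ cong (λ x → suc N * (2 * x)) (u-ode u N) ⟩
      suc N * (2 * (s * (y ⊛ u) N))
        ≡⟨ cong (λ x → suc N * (2 * (s * x))) (⊛-comm y u N) ⟩
      suc N * (2 * (s * B N)) ∎)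
      where
      open ≡-Reasoning
      a = (u ∘ suc ⊛ u) N
      regroup : ∀ n a b → n * a + n * a + n * (2 * b) ≡ n * (2 * (a + b))
      regroup = solve-∀

    A-Q : ∀ N → suc N * (suc N * A s (suc N) + N * A s N) ≡ 2 * Q (suc N) + suc N * (2 * s * A s N)
    A-Q N = begin
      suc N * (suc N * A s (suc N) + N * A s N)
        ≡⟨ cong₂ (λ a b → suc N * (a + b)) (A-B (suc N)) (A-B N) ⟩
      suc N * (2 * B (suc N) + 2 * B N)
        ≡⟨ regroup (suc N) (B (suc N)) (B N) ⟩
      2 * (suc N * B (suc N) + suc N * B N)
        ≡⟨ cong (2 *_) (B-Q N) ⟩
      2 * (Q (suc N) + suc N * (s * A s N))
        ≡⟨ collect (suc N) s (Q (suc N)) (A s N) ⟩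
      2 * Q (suc N) + suc N * (2 * s * A s N) ∎
      where
      open ≡-Reasoning
      regroup : ∀ n a b → n * (2 * a + 2 * b) ≡ 2 * (n * a + n * b)
      regroup = solve-∀
      collect : ∀ n s a b → 2 * (a + n * (s * b)) ≡ 2 * a + n * (2 * s * b)
      collect = solve-∀

  -- `A-Q` at `N` plus twice `A-Q` at `n` produces `Q (suc N) + 2 * Q N`, which `Q-B` turns into a
  -- multiple of `B N` and `A-B` into a multiple of `N * A s N`.
  A-recurrence : ∀ n → let N = suc n in
    suc N * (suc N * A s (suc N) + N * A s N) + 2 * (N * (N * A s N + n * A s n))
      ≡ 2 * s * ((2 * N + 1) * A s N + 2 * N * A s n)
  A-recurrence n = begin
    suc N * (suc N * A s (suc N) + N * A s N) + 2 * (N * (N * A s N + n * A s n))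
      ≡⟨ cong₂ (λ a b → a + 2 * b) (A-Q N) (A-Q n) ⟩
    (2 * Q (suc N) + suc N * (2 * s * A s N)) + 2 * (2 * Q N + N * (2 * s * A s n))
      ≡⟨ regroup (Q (suc N)) (Q N) n s (A s N) (A s n) ⟩
    2 * (Q (suc N) + 2 * Q N) + 2 * s * (suc N * A s N + 2 * N * A s n)
      ≡⟨ cong (λ x → 2 * x + 2 * s * (suc N * A s N + 2 * N * A s n)) (Q-B N) ⟩
    2 * (2 * (s * B N)) + 2 * s * (suc N * A s N + 2 * N * A s n)
      ≡⟨ pull s (B N) _ ⟩
    2 * s * (2 * B N + (suc N * A s N + 2 * N * A s n))
      ≡⟨ cong (λ x → 2 * s * (x + (suc N * A s N + 2 * N * A s n))) (A-B N) ⟨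
    2 * s * (N * A s N + (suc N * A s N + 2 * N * A s n))
      ≡⟨ collect s n (A s N) (A s n) ⟩
    2 * s * ((2 * N + 1) * A s N + 2 * N * A s n) ∎
    where
    open ≡-Reasoning
    N = suc n
    regroup : ∀ p q n s a b →
      (2 * p + suc (suc n) * (2 * s * a)) + 2 * (2 * q + suc n * (2 * s * b))
        ≡ 2 * (p + 2 * q) + 2 * s * (suc (suc n) * a + 2 * suc n * b)
    regroup = solve-∀
    pull : ∀ s b c → 2 * (2 * (s * b)) + 2 * s * c ≡ 2 * s * (2 * b + c)
    pull = solve-∀
    collect : ∀ s n a b → 2 * s * (suc n * a + (suc (suc n) * a + 2 * suc n * b))
                        ≡ 2 * s * ((2 * suc n + 1) * a + 2 * suc n * b)
    collect = solve-∀

  A-1 : A s 1 ≡ 2 * s * A s 0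
  A-1 = trans (cong (λ c → c * (s C 0) + (s C 0) * c) (nC1≡n s)) (collect s)
    where
    collect : ∀ s → s * 1 + 1 * s ≡ 2 * s * (1 * 1)
    collect = solve-∀

open import Data.Integer using (+_)

A-recurrentSequence : ∀ s → 0 < s → RecurrentSequence (2 * s) (A s)
A-recurrentSequence s 0<s = record
  { recurrence = λ n → trans (sym (left n (A s n) (A s (suc n)) (A s (suc (suc n)))))
                      (trans (cong +_ (A-recurrence s n)) (right (2 * s) (suc n) (A s n) (A s (suc n))))
  ; initial    = A-1 s
  ; terminal   = A-zero s (suc (2 * s)) ≤-refl
  ; 2≤M        = *-monoʳ-≤ 2 0<s
  }
  where
  left : ∀ n a b c → let N = suc n in
    + (suc N * (suc N * c + N * b) + 2 * (N * (N * b + n * a)))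
      ≡ + suc N ℤ.* (+ suc N ℤ.* + c ℤ.+ + N ℤ.* + b) ℤ.+ + 2 ℤ.* (+ N ℤ.* (+ N ℤ.* + b ℤ.+ + n ℤ.* + a))
  left n a b c = cong₂ ℤ._+_
    (trans (ℤ.pos-* (suc N) (suc N * c + N * b))
           (cong (+ suc N ℤ.*_) (cong₂ ℤ._+_ (ℤ.pos-* (suc N) c) (ℤ.pos-* N b))))
    (trans (ℤ.pos-* 2 (N * (N * b + n * a))) (cong (+ 2 ℤ.*_)
      (trans (ℤ.pos-* N (N * b + n * a)) (cong (+ N ℤ.*_) (cong₂ ℤ._+_ (ℤ.pos-* N b) (ℤ.pos-* n a))))))
    where N = suc n
  right : ∀ M N a b → + (M * ((2 * N + 1) * b + 2 * N * a))
    ≡ + M ℤ.* ((+ 2 ℤ.* + N ℤ.+ + 1) ℤ.* + b ℤ.+ + 2 ℤ.* + N ℤ.* + a)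
  right M N a b = trans (ℤ.pos-* M ((2 * N + 1) * b + 2 * N * a)) (cong (+ M ℤ.*_) (cong₂ ℤ._+_
    (trans (ℤ.pos-* (2 * N + 1) b) (cong (λ t → (t ℤ.+ + 1) ℤ.* + b) (ℤ.pos-* 2 N)))
    (trans (ℤ.pos-* (2 * N) a) (cong (ℤ._* + a) (ℤ.pos-* 2 N)))))

-- Comparison of consecutive values of `f`.

C-ratio : ∀ n k → suc k * (n C suc k) ≡ (n ∸ k) * (n C k)
C-ratio n k with ≤-<-connex k n
... | inj₁ k≤n = +-cancelʳ-≡ (k * (n C k)) _ _ (begin
  suc k * (n C suc k) + k * (n C k)    ≡⟨ C-absorption n k ⟩
  n * (n C k)                          ≡⟨ cong (_* (n C k)) (m∸n+n≡m k≤n) ⟨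
  (n ∸ k + k) * (n C k)                ≡⟨ *-distribʳ-+ (n C k) (n ∸ k) k ⟩
  (n ∸ k) * (n C k) + k * (n C k)      ∎)
  where open ≡-Reasoning
... | inj₂ n<k = begin
  suc k * (n C suc k)   ≡⟨ cong (suc k *_) (k>n⇒nCk≡0 (m≤n⇒m≤1+n n<k)) ⟩
  suc k * 0             ≡⟨ *-zeroʳ (suc k) ⟩
  0                     ≡⟨ *-zeroʳ (n ∸ k) ⟨
  (n ∸ k) * 0           ≡⟨ cong ((n ∸ k) *_) (k>n⇒nCk≡0 n<k) ⟨
  (n ∸ k) * (n C k)     ∎
  where open ≡-Reasoning

private
  swapˡ : ∀ x y z → x * (y * z) ≡ y * (x * z)
  swapˡ = solve-∀

module _ (s₁ s₂ N : ℕ) where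
  -- Multiplication by `suc N` gives the values of `f` at `N` and `suc N` the common factor
  -- `s₂ C N`, so that only the ratio of consecutive values of `A s₁` matters.
  scaled-f : suc N * f s₁ s₂ N ≡ (s₂ C N) * (suc N * A s₁ N)
  scaled-f = trans (cong (suc N *_) (f-factor s₁ s₂ N)) (swapˡ (suc N) (s₂ C N) _)

  scaled-f-suc : suc N * f s₁ s₂ (suc N) ≡ (s₂ C N) * ((s₂ ∸ N) * A s₁ (suc N))
  scaled-f-suc = begin
    suc N * f s₁ s₂ (suc N)                    ≡⟨ cong (suc N *_) (f-factor s₁ s₂ (suc N)) ⟩
    suc N * ((s₂ C suc N) * A s₁ (suc N))      ≡⟨ *-assoc (suc N) (s₂ C suc N) _ ⟨
    suc N * (s₂ C suc N) * A s₁ (suc N)        ≡⟨ cong (_* A s₁ (suc N)) (C-ratio s₂ N) ⟩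
    (s₂ ∸ N) * (s₂ C N) * A s₁ (suc N)         ≡⟨ *-assoc (s₂ ∸ N) (s₂ C N) _ ⟩
    (s₂ ∸ N) * ((s₂ C N) * A s₁ (suc N))       ≡⟨ swapˡ (s₂ ∸ N) (s₂ C N) _ ⟩
    (s₂ C N) * ((s₂ ∸ N) * A s₁ (suc N))       ∎
    where open ≡-Reasoning

  f-increasing : suc N * A s₁ N ≤ (s₂ ∸ N) * A s₁ (suc N) → f s₁ s₂ N ≤ f s₁ s₂ (suc N)
  f-increasing h = *-cancelˡ-≤ (suc N)
    (subst₂ _≤_ (sym scaled-f) (sym scaled-f-suc) (*-monoʳ-≤ (s₂ C N) h))

  f-decreasing : (s₂ ∸ N) * A s₁ (suc N) ≤ suc N * A s₁ N → f s₁ s₂ (suc N) ≤ f s₁ s₂ N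
  f-decreasing h = *-cancelˡ-≤ (suc N)
    (subst₂ _≤_ (sym scaled-f-suc) (sym scaled-f) (*-monoʳ-≤ (s₂ C N) h))

-- The floor of X in natural-number arithmetic.

-- BelowRoot m says √(4D) ≤ 2A, which already forces the truncated 2A to be positive.
module _ (s S : ℕ) where
  2X : ℕ
  2X = 4 * s + 2 * S + 3

  4D : ℕ
  4D = 16 * s * s + 16 * s + (2 * S + 1) * (2 * S + 1)

  2A : ℕ → ℕ
  2A m = 2X ∸ 2 * m

  BelowRoot : ℕ → Set
  BelowRoot m = 4D ≤ 2A m * 2A m

  belowRoot? : Decidable BelowRoot
  belowRoot? m = 4D ≤? 2A m * 2A m

  belowRoot-antitone : ∀ {m n} → m ≤ n → BelowRoot n → BelowRoot m
  belowRoot-antitone m≤n h = ≤-trans h (*-mono-≤ 2A-antitone 2A-antitone)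
    where 2A-antitone = ∸-monoʳ-≤ 2X (*-monoʳ-≤ 2 m≤n)

  belowRoot-zero : BelowRoot 0
  belowRoot-zero = ≤-trans (m≤m+n 4D _) (≤-reflexive (sym (expand s S)))
    where
    expand : ∀ s S → (4 * s + 2 * S + 3) * (4 * s + 2 * S + 3)
      ≡ 16 * s * s + 16 * s + (2 * S + 1) * (2 * S + 1) + (16 * s * S + 8 * s + 8 * S + 8)
    expand = solve-∀

  4D>0 : 0 < 4D
  4D>0 = ≤-trans (*-mono-≤ (m≤n+m 1 (2 * S)) (m≤n+m 1 (2 * S))) (m≤n+m _ (16 * s * s + 16 * s))

  belowRoot⇒2m≤2X : ∀ m → BelowRoot m → 2 * m ≤ 2X
  belowRoot⇒2m≤2X m h with ≤-<-connex (2 * m) 2X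
  ... | inj₁ 2m≤2X = 2m≤2X
  ... | inj₂ 2X<2m = contradiction (subst (λ e → 4D ≤ e * e) (m≤n⇒m∸n≡0 (<⇒≤ 2X<2m)) h) (<⇒≱ 4D>0)

  -- A crude upper end for the search of the floor: `2 * m` exceeds `2X` at `m = 2X`.
  ¬belowRoot-2X : ¬ BelowRoot 2X
  ¬belowRoot-2X h = <⇒≱ (m<m+n 2X 2X>0) (≤-trans (≤-reflexive (cong (λ t → 2X + t) (sym (+-identityʳ 2X)))) (belowRoot⇒2m≤2X 2X h))
    where
    2X>0 : 0 < 2X
    2X>0 = ≤-trans (s≤s z≤n) (m≤n+m 3 (4 * s + 2 * S))

  twoA≡2A : ∀ m → 2 * m ≤ 2X → twoA s S (+ m) ≡ + 2A m
  twoA≡2A m 2m≤2X = begin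
    + 2X ℤ.- + 2 ℤ.* + m     ≡⟨ cong (λ t → + 2X ℤ.- t) (ℤ.pos-* 2 m) ⟨
    + 2X ℤ.- + (2 * m)       ≡⟨ ℤ.m-n≡m⊖n 2X (2 * m) ⟩
    2X ℤ.⊖ 2 * m             ≡⟨ ℤ.⊖-≥ 2m≤2X ⟩
    + 2A m                   ∎
    where open ≡-Reasoning

  isFloorG : ∀ m → BelowRoot m → ¬ BelowRoot (suc m) → IsFloorG s S (+ m)
  isFloorG m h ¬h rewrite twoA≡2A m (belowRoot⇒2m≤2X m h) =
    (+≤+ z≤n , subst (+ 4D ℤ.≤_) (ℤ.pos-* (2A m) (2A m)) (+≤+ h)) , above (2A m) refl
    where
    above : ∀ e → 2A m ≡ e →
      + e ℤ.- + 2 ℤ.< + 0 ⊎ (+ e ℤ.- + 2) ℤ.* (+ e ℤ.- + 2) ℤ.< fourD s S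
    -- If `2A m` is 0 or 1, subtracting 2 gives a negative integer and the first disjunct holds;
    -- from 2 on, the difference `e` is `2A (suc m)`.
    above zero          _  = inj₁ ℤ.-<+
    above (suc zero)    _  = inj₁ ℤ.-<+
    above (suc (suc e)) eq = inj₂ (subst (ℤ._< + 4D) (ℤ.pos-* e e)
      (+<+ (subst (λ t → t * t < 4D) next (≰⇒> ¬h))))
      where
      next : 2A (suc m) ≡ e
      next = begin
        2X ∸ 2 * suc m      ≡⟨ cong (2X ∸_) (*-suc 2 m) ⟩
        2X ∸ (2 + 2 * m)    ≡⟨ cong (2X ∸_) (+-comm 2 (2 * m)) ⟩
        2X ∸ (2 * m + 2)    ≡⟨ ∸-+-assoc 2X (2 * m) 2 ⟨
        2A m ∸ 2            ≡⟨ cong (_∸ 2) eq ⟩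
        e                   ∎
        where open ≡-Reasoning

  -- Monotonicity of `f` on both sides of the floor.

  module _ (0<s : 0 < s) where
    private
      M : ℕ
      M = 2 * s
      R = A-recurrentSequence s 0<s

      4D≡ : 4D ≡ 4 * M * M + 8 * M + (2 * S + 1) * (2 * S + 1)
      4D≡ = expand s S
        where
        expand : ∀ s S → 16 * s * s + 16 * s + (2 * S + 1) * (2 * S + 1)
          ≡ 4 * (2 * s) * (2 * s) + 8 * (2 * s) + (2 * S + 1) * (2 * S + 1)
        expand = solve-∀

      2X≡ : 2X ≡ 2 * M + 2 * S + 3
      2X≡ = expand s S
        where
        expand : ∀ s S → 4 * s + 2 * S + 3 ≡ 2 * (2 * s) + 2 * S + 3
        expand = solve-∀

    -- `2A (suc M)` is `2 * S + 1`, whose square is already less than `4D`; antitonicity excludes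
    -- all later indices.
    belowRoot⇒<M : ∀ N → BelowRoot (suc N) → N < M
    belowRoot⇒<M N h with <-≤-connex N M
    ... | inj₁ N<M = N<M
    ... | inj₂ M≤N = contradiction (≤-trans (belowRoot-antitone (s≤s M≤N) h) (≤-reflexive square)) (<⇒≱ (begin-strict
      (2 * S + 1) * (2 * S + 1)
        <⟨ m<n+m _ (≤-trans (≤-trans 0<s (m≤m*n s 16)) (≤-trans (≤-reflexive (*-comm s 16)) (m≤n+m (16 * s) (16 * s * s)))) ⟩
      4D ∎))
      where
      open ≤-Reasoning
      2A≡ : 2A (suc M) ≡ 2 * S + 1
      2A≡ = trans (cong (_∸ 2 * suc M) (trans 2X≡ (split M S))) (m+n∸n≡m (2 * S + 1) (2 * suc M))
        where
        split : ∀ M S → 2 * M + 2 * S + 3 ≡ 2 * S + 1 + 2 * suc M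
        split = solve-∀
      square : 2A (suc M) * 2A (suc M) ≡ (2 * S + 1) * (2 * S + 1)
      square = cong₂ _*_ 2A≡ 2A≡

    -- The same argument with `2A (suc S)` equal to `4 * s + 1`.
    belowRoot⇒<S : ∀ N → BelowRoot (suc N) → N < S
    belowRoot⇒<S N h with <-≤-connex N S
    ... | inj₁ N<S = N<S
    ... | inj₂ S≤N = contradiction (≤-trans (belowRoot-antitone (s≤s S≤N) h) (≤-reflexive square)) (<⇒≱ (begin-strict
      (4 * s + 1) * (4 * s + 1)
        <⟨ m<m+n _ (≤-trans 0<s (≤-trans (m≤m*n s 8) (≤-trans (≤-reflexive (*-comm s 8)) (m≤m+n (8 * s) _)))) ⟩
      (4 * s + 1) * (4 * s + 1) + (8 * s + (4 * S * S + 4 * S))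
        ≡⟨ expand s S ⟨
      4D ∎))
      where
      open ≤-Reasoning
      expand : ∀ s S → 16 * s * s + 16 * s + (2 * S + 1) * (2 * S + 1)
        ≡ (4 * s + 1) * (4 * s + 1) + (8 * s + (4 * S * S + 4 * S))
      expand = solve-∀
      2A≡ : 2A (suc S) ≡ 4 * s + 1
      2A≡ = trans (cong (_∸ 2 * suc S) (split s S)) (m+n∸n≡m (4 * s + 1) (2 * suc S))
        where
        split : ∀ s S → 4 * s + 2 * S + 3 ≡ 4 * s + 1 + 2 * suc S
        split = solve-∀
      square : 2A (suc S) * 2A (suc S) ≡ (4 * s + 1) * (4 * s + 1)
      square = cong₂ _*_ 2A≡ 2A≡

    -- In terms of `Z` and `W`, both `4D` and the square of `2A (suc N)` contain the summand `K`;
    -- what remains is four times the claim. Its left side is the coefficient in `ratio-lower`.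
    belowRoot⇒quadratic : ∀ N Z W → N + Z ≡ M → N + W ≡ S → BelowRoot (suc N) →
      N * N + 2 * N + Z ≤ 2 * Z * W
    belowRoot⇒quadratic N Z W eM eS h = *-cancelˡ-≤ 4 (+-cancelˡ-≤ K _ _ (subst₂ _≤_
      (trans 4D≡ (trans (cong₂ (λ m t → 4 * m * m + 8 * m + (2 * t + 1) * (2 * t + 1)) (sym eM) (sym eS)) (4D-split N Z W)))
      (trans (cong₂ _*_ 2A≡ 2A≡) (square-split N Z W)) h))
      where
      K = 4 * Z * Z + 8 * N * Z + 4 * Z + (2 * (N + W) + 1) * (2 * (N + W) + 1)
      4D-split : ∀ N Z W →
        4 * (N + Z) * (N + Z) + 8 * (N + Z) + (2 * (N + W) + 1) * (2 * (N + W) + 1)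
        ≡ 4 * Z * Z + 8 * N * Z + 4 * Z + (2 * (N + W) + 1) * (2 * (N + W) + 1) + 4 * (N * N + 2 * N + Z)
      4D-split = solve-∀
      square-split : ∀ N Z W →
        (2 * Z + 2 * W + 2 * N + 1) * (2 * Z + 2 * W + 2 * N + 1)
        ≡ 4 * Z * Z + 8 * N * Z + 4 * Z + (2 * (N + W) + 1) * (2 * (N + W) + 1) + 4 * (2 * Z * W)
      square-split = solve-∀
      2A≡ : 2A (suc N) ≡ 2 * Z + 2 * W + 2 * N + 1
      2A≡ = trans (cong (_∸ 2 * suc N) (trans 2X≡ (trans (cong₂ (λ m t → 2 * m + 2 * t + 3) (sym eM) (sym eS)) (split N Z W))))
                  (m+n∸n≡m (2 * Z + 2 * W + 2 * N + 1) (2 * suc N))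
        where
        split : ∀ N Z W → 2 * (N + Z) + 2 * (N + W) + 3 ≡ 2 * Z + 2 * W + 2 * N + 1 + 2 * suc N
        split = solve-∀

    -- After cancelling `K`, failure of `BelowRoot N` reads `2 * Z * W + (Z + 2 * W + 2) < N * N`;
    -- the bracket is then dropped.
    ¬belowRoot⇒quadratic : ∀ N Z W → N + Z ≡ M → N + W ≡ S → ¬ BelowRoot N → 2 * Z * W ≤ N * N
    ¬belowRoot⇒quadratic N Z W eM eS ¬h = ≤-trans (m≤m+n (2 * Z * W) (Z + 2 * W + 2)) (<⇒≤ (*-cancelˡ-< 4 _ _ (+-cancelˡ-< K _ _ (subst₂ _<_
      (trans (cong₂ _*_ 2A≡ 2A≡) (square-split N Z W))
      (trans 4D≡ (trans (cong₂ (λ m t → 4 * m * m + 8 * m + (2 * t + 1) * (2 * t + 1)) (sym eM) (sym eS)) (4D-split N Z W)))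
      (≰⇒> ¬h)))))
      where
      K = 4 * Z * Z + 8 * N * Z + 8 * Z + 8 * N + (2 * (N + W) + 1) * (2 * (N + W) + 1)
      4D-split : ∀ N Z W →
        4 * (N + Z) * (N + Z) + 8 * (N + Z) + (2 * (N + W) + 1) * (2 * (N + W) + 1)
        ≡ 4 * Z * Z + 8 * N * Z + 8 * Z + 8 * N + (2 * (N + W) + 1) * (2 * (N + W) + 1) + 4 * (N * N)
      4D-split = solve-∀
      square-split : ∀ N Z W →
        (2 * Z + 2 * W + 2 * N + 3) * (2 * Z + 2 * W + 2 * N + 3)
        ≡ 4 * Z * Z + 8 * N * Z + 8 * Z + 8 * N + (2 * (N + W) + 1) * (2 * (N + W) + 1)
          + 4 * (2 * Z * W + (Z + 2 * W + 2))
      square-split = solve-∀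
      2A≡ : 2A N ≡ 2 * Z + 2 * W + 2 * N + 3
      2A≡ = trans (cong (_∸ 2 * N) (trans 2X≡ (trans (cong₂ (λ m t → 2 * m + 2 * t + 3) (sym eM) (sym eS)) (split N Z W))))
                  (m+n∸n≡m (2 * Z + 2 * W + 2 * N + 3) (2 * N))
        where
        split : ∀ N Z W → 2 * (N + Z) + 2 * (N + W) + 3 ≡ 2 * Z + 2 * W + 2 * N + 3 + 2 * N
        split = solve-∀

    increasing-below : ∀ N → BelowRoot (suc N) → f s S N ≤ f s S (suc N)
    increasing-below N h with m≤n⇒∃[o]m+o≡n (belowRoot⇒<M N h) | m≤n⇒∃[o]m+o≡n (belowRoot⇒<S N h)
    -- `N < M` makes the factor `2 * suc z` of `ratio-lower` positive, hence cancellable; `N < S`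
    -- makes `S ∸ N` a true difference.
    ... | z , eM | w , eS = f-increasing s S N (*-cancelˡ-≤ (2 * suc z) (begin
      2 * suc z * (suc N * A s N)                          ≤⟨ ratio-lower R N z eM′ ⟩
      (N * N + 2 * N + suc z) * A s (suc N)
        ≤⟨ *-monoˡ-≤ (A s (suc N)) (belowRoot⇒quadratic N (suc z) (suc w) eM′ eS′ h) ⟩
      2 * suc z * suc w * A s (suc N)                      ≡⟨ *-assoc (2 * suc z) (suc w) _ ⟩
      2 * suc z * (suc w * A s (suc N))
        ≡⟨ cong (λ t → 2 * suc z * (t * A s (suc N))) (trans (cong (_∸ N) (sym eS′)) (m+n∸m≡n N (suc w))) ⟨
      2 * suc z * ((S ∸ N) * A s (suc N))                  ∎))
      where
      open ≤-Reasoning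
      eM′ = trans (+-suc N z) eM
      eS′ = trans (+-suc N w) eS

    decreasing-above : ∀ N → ¬ BelowRoot N → f s S (suc N) ≤ f s S N
    decreasing-above N ¬h with <-≤-connex M N | ≤-<-connex N S
    -- Beyond `M` the factor `A s (suc N)` vanishes, beyond `S` the factor `S ∸ N`; the ratio bound
    -- handles the common range.
    ... | inj₁ M<N | _        = f-decreasing s S N (≤-trans (≤-reflexive
          (trans (cong ((S ∸ N) *_) (A-zero s (suc N) (m≤n⇒m≤1+n M<N))) (*-zeroʳ (S ∸ N)))) z≤n)
    ... | inj₂ _   | inj₂ S<N = f-decreasing s S N (≤-trans (≤-reflexive
          (cong (_* A s (suc N)) (m≤n⇒m∸n≡0 (<⇒≤ S<N)))) z≤n)
    ... | inj₂ N≤M | inj₁ N≤S with m≤n⇒∃[o]m+o≡n N≤M | m≤n⇒∃[o]m+o≡n N≤S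
    ... | z , eM | w , eS = f-decreasing s S N (*-cancelˡ-≤ (suc N) (begin
      suc N * ((S ∸ N) * A s (suc N))
        ≡⟨ cong (λ t → suc N * (t * A s (suc N))) (trans (cong (_∸ N) (sym eS)) (m+n∸m≡n N w)) ⟩
      suc N * (w * A s (suc N))       ≡⟨ swapˡ (suc N) w _ ⟩
      w * (suc N * A s (suc N))       ≤⟨ *-monoʳ-≤ w (ratio-upper R N z eM) ⟩
      w * (2 * z * A s N)             ≡⟨ regroup w z (A s N) ⟩
      2 * z * w * A s N               ≤⟨ *-monoˡ-≤ (A s N) (¬belowRoot⇒quadratic N z w eM eS ¬h) ⟩
      N * N * A s N                   ≤⟨ *-monoˡ-≤ (A s N) (*-mono-≤ (n≤1+n N) (n≤1+n N)) ⟩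
      suc N * suc N * A s N           ≡⟨ *-assoc (suc N) (suc N) _ ⟩
      suc N * (suc N * A s N)         ∎))
      where
      open ≤-Reasoning
      regroup : ∀ w z a → w * (2 * z * a) ≡ 2 * z * w * a
      regroup = solve-∀

    IsMode : ℕ → Set
    IsMode g = (∀ N → suc N ≤ g → f s S N ≤ f s S (suc N))
             × (∀ N → g ≤ N → f s S (suc N) ≤ f s S N)

    -- `f` rises up to `m` and falls from `suc m` on; whichever of these two indices has the larger
    -- value is the mode, giving δ = 0 or δ = 1.
    mode : ∀ m → BelowRoot m → ¬ BelowRoot (suc m) → IsMode m ⊎ IsMode (suc m)
    mode m h ¬h = choose (≤-total (f s S (suc m)) (f s S m))
      where
      up : ∀ N → suc N ≤ m → f s S N ≤ f s S (suc N)
      up N N<m = increasing-below N (belowRoot-antitone N<m h)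
      down : ∀ N → suc m ≤ N → f s S (suc N) ≤ f s S N
      down N m<N = decreasing-above N λ h′ → ¬h (belowRoot-antitone m<N h′)
      choose : f s S (suc m) ≤ f s S m ⊎ f s S m ≤ f s S (suc m) → IsMode m ⊎ IsMode (suc m)
      choose (inj₁ drop) = inj₁ (up , λ N m≤N → down′ N (m≤n⇒m<n∨m≡n m≤N))
        where
        down′ : ∀ N → m < N ⊎ m ≡ N → f s S (suc N) ≤ f s S N
        down′ N (inj₁ m<N)  = down N m<N
        down′ N (inj₂ refl) = drop
      choose (inj₂ rise) = inj₂ ((λ N N<1+m → up′ N (m≤n⇒m<n∨m≡n (s≤s⁻¹ N<1+m))) , down)
        where
        up′ : ∀ N → N < m ⊎ N ≡ m → f s S N ≤ f s S (suc N)
        up′ N (inj₁ N<m)  = up N N<m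
        up′ N (inj₂ refl) = rise

    mode-near-floor : ∃[ m ] (BelowRoot m × ¬ BelowRoot (suc m)) →
      ∃[ g ] (IsMode g × ∃[ m ] (IsFloorG s S m × ((+ g ≡ m) ⊎ (+ g ≡ m ℤ.+ + 1))))
    mode-near-floor (m , h , ¬h) with mode m h ¬h
    ... | inj₁ isMode = m , isMode , + m , isFloorG m h ¬h , inj₁ refl
    ... | inj₂ isMode = suc m , isMode , + m , isFloorG m h ¬h , inj₂ (cong +_ (+-comm 1 m))

-- Descends from `k` until `P` holds, at the latest at 0.
lastTrue : ∀ {P : ℕ → Set} → Decidable P → P 0 → ∀ k → ¬ P k → ∃[ m ] (P m × ¬ P (suc m))
lastTrue P? p₀ zero    ¬pk = contradiction p₀ ¬pk
lastTrue P? p₀ (suc k) ¬pk with P? k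
... | yes pk = k , pk , ¬pk
... | no ¬pk′ = lastTrue P? p₀ k ¬pk′


theorem1p1 : (s₁ s₂ : ℕ) → 0 < s₁ → 0 < s₂ →
    ∃[ g ] ((∀ N → suc N ≤ g → f s₁ s₂ N ≤ f s₁ s₂ (suc N))
    × (∀ N → g ≤ N → f s₁ s₂ (suc N) ≤ f s₁ s₂ N)
    × ∃[ m ] (IsFloorG s₁ s₂ m × ((+ g ≡ m) ⊎ (+ g ≡ m ℤ.+ + 1))))
theorem1p1 s₁ s₂ 0<s₁ _ =
  -- The last index satisfying the antitone `BelowRoot` is the floor of X, found between 0 and `2X`.
  let g , (increasing , decreasing) , floor = mode-near-floor s₁ s₂ 0<s₁
        (lastTrue {BelowRoot s₁ s₂} (belowRoot? s₁ s₂) (belowRoot-zero s₁ s₂) (2X s₁ s₂) (¬belowRoot-2X s₁ s₂))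
  in g , increasing , decreasing , floor
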